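{- Let $\rho$ be an $i$-polymatroid on a finite set $E$ and let $\rho^*$ be its $i$-dual. If $M_1,\dots,M_i$ are matroids on $E$ with $\rho=r_{M_1}+\cdots+r_{M_i}$, then $\rho^*=r_{M_1^*}+\cdots+r_{M_i^*}$. More generally, if $k\ge i$ and $M_1,\dots,M_k$ are matroids on $E$ with $\rho=r_{M_1}+\cdots+r_{M_k}$, then there are matroids $M'_1,\dots,M'_k$ on $E$ with $\rho^*=r_{M'_1}+\cdots+r_{M'_k}$ such that, for every $s\in[k]$, the matroid obtained from $M'_s$ by deleting its loops and coloops is the dual of the matroid obtained from $M_s$ by deleting its loops and coloops. Consequently, if $\min(\chi(\rho),\chi(\rho^*))\ge i$, then $\chi(\rho)=\chi(\rho^*)$.
   Context: A polymatroid on $E$ is a function $\rho:2^E\to\mathbb{Z}$ that is normalized, non-decreasing and submodular; it is an $i$-polymatroid if $\rho(\{e\})\le i$ for all $e\in E$. The $i$-dual of an $i$-polymatroid $\rho$ is $\rho^*(X)=i|X|-\rho(E)+\rho(E-X)$ for $X\subseteq E$. $M^*$ denotes the dual matroid. The chromatic number $\chi(\rho)$ is the least positive integer $k$ such that $\rho=r_{M_1}+\cdots+r_{M_k}$ for some matroids $M_1,\dots,M_k$ on $E$, and $\infty$ if there is no such $k$. -}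

module Defs where

open import Level using (0ℓ)
open import Data.Bool.Base using (true; false; _∧_)
open import Data.Empty using (⊥-elim)
open import Data.Fin.Base using (Fin; zero; suc; toℕ; fromℕ<)
import Data.Fin.Properties as Fin
open import Data.Fin.Subset hiding (_-_)
open import Data.Fin.Subset.Properties
open import Data.Integer.Base as ℤ
  using (ℤ; +_; 0ℤ; 1ℤ; _+_; _-_; _*_; _≤_; +≤+)
import Data.Integer.Properties as ℤ
open import Data.Integer.Tactic.RingSolver using (solve-∀)
open import Data.Nat.Base as ℕ using (ℕ; zero; suc; z≤n; s≤s)
import Data.Nat.Properties as ℕ
open import Data.Nat.Induction using (<-wellFounded)
open import Data.Product using (∃; _×_; _,_; proj₁; proj₂)
open import Data.Sum.Base using (_⊎_; inj₁; inj₂)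
open import Data.Vec.Base using ([]; _∷_; tabulate; here; there)
open import Data.Vec.Functional using (Vector; removeAt)
open import Function.Base using (_∘_)
open import Function.Bundles using (_⇔_; mk⇔)
open import Induction.WellFounded using (Acc; acc)
open import Relation.Binary.Bundles using (TotalOrder)
open import Relation.Binary.PropositionalEquality
open import Relation.Nullary
open import Relation.Nullary.Construct.Add.Supremum using (_⁺; [_]; ⊤⁺)
open import Relation.Nullary.Decidable
  using (map′; _×-dec_; _→-dec_; decidable-stable)
import Relation.Binary.Construct.Add.Supremum.NonStrict as AddSupremum
import Algebra.Construct.NaturalChoice.Min as Min

open import Algebra.Properties.CommutativeMonoid.Sum ℤ.+-0-commutativeMonoid public
  using (sum)
open import Algebra.Properties.CommutativeMonoid.Sum ℤ.+-0-commutativeMonoid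
  using (sum-remove; sum-cong-≗)

private
  variable
    n i k : ℕ

------------------------------------------------------------------------
-- Polymatroids and matroids

-- Ground sets are arbitrary subsets E of some Fin n, so that deletion
-- stays inside the framework.  A function on 2^E is represented by a
-- function on all of Subset n; its values at sets X ⊈ E are junk, and
-- every notion below looks only at sets X ⊆ E.

record IsPolymatroid (E : Subset n) (ρ : Subset n → ℤ) : Set where
  field
    normalized : ρ ⊥ ≡ 0ℤ
    monotone   : ∀ {X Y} → X ⊆ Y → Y ⊆ E → ρ X ≤ ρ Y
    submodular : ∀ {X Y} → X ⊆ E → Y ⊆ E →
                 ρ (X ∪ Y) + ρ (X ∩ Y) ≤ ρ X + ρ Y

record Polymatroid (E : Subset n) : Set where
  field
    rank          : Subset n → ℤ
    isPolymatroid : IsPolymatroid E rank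

infix 8 _-Polymatroid_

record _-Polymatroid_ (i : ℕ) (E : Subset n) : Set where
  field
    polymatroid : Polymatroid E
    bounded     : ∀ {e} → e ∈ E → Polymatroid.rank polymatroid ⁅ e ⁆ ≤ + i

open Polymatroid using (rank) public
open _-Polymatroid_ using (polymatroid) public

-- A matroid is given by its rank function.

Matroid : Subset n → Set
Matroid E = 1 -Polymatroid E

r : {E : Subset n} → Matroid E → Subset n → ℤ
r M = rank (polymatroid M)

infix 4 _≅_

_≅_ : {E F : Subset n} → Matroid E → Matroid F → Set
_≅_ {E = E} {F} M N = E ≡ F × (∀ {X} → X ⊆ E → r M X ≡ r N X)

------------------------------------------------------------------------
-- Facts about finite sets and polymatroids used to construct duals

x∈p─q⇒x∉q : ∀ {x : Fin n} (p q : Subset n) → x ∈ p ─ q → x ∉ q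
x∈p─q⇒x∉q (true ∷ p) (true ∷ q) () here
x∈p─q⇒x∉q (_ ∷ p) (_ ∷ q) (there u) (there v) = x∈p─q⇒x∉q p q u v

─-anti : ∀ {X Y : Subset n} E → X ⊆ Y → E ─ Y ⊆ E ─ X
─-anti {Y = Y} E X⊆Y e∈ =
  x∈p∧x∉q⇒x∈p─q (p─q⊆p E Y e∈) (x∈p─q⇒x∉q E Y e∈ ∘ X⊆Y)

∣─∣ : {X E : Subset n} → X ⊆ E → ∣ E ─ X ∣ ℕ.+ ∣ X ∣ ≡ ∣ E ∣
∣─∣ {X = []} {[]} X⊆E = refl
∣─∣ {X = false ∷ X} {false ∷ E} X⊆E = ∣─∣ (drop-∷-⊆ X⊆E)
∣─∣ {X = false ∷ X} {true ∷ E} X⊆E = cong suc (∣─∣ (drop-∷-⊆ X⊆E))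
∣─∣ {X = true ∷ X} {false ∷ E} X⊆E with () ← X⊆E here
∣─∣ {X = true ∷ X} {true ∷ E} X⊆E =
  trans (ℕ.+-suc ∣ E ─ X ∣ ∣ X ∣) (cong suc (∣─∣ (drop-∷-⊆ X⊆E)))

∣∪∣+∣∩∣ : (X Y : Subset n) → ∣ X ∪ Y ∣ ℕ.+ ∣ X ∩ Y ∣ ≡ ∣ X ∣ ℕ.+ ∣ Y ∣
∣∪∣+∣∩∣ [] [] = refl
∣∪∣+∣∩∣ (false ∷ X) (false ∷ Y) = ∣∪∣+∣∩∣ X Y
∣∪∣+∣∩∣ (false ∷ X) (true ∷ Y) =
  trans (cong suc (∣∪∣+∣∩∣ X Y)) (sym (ℕ.+-suc ∣ X ∣ ∣ Y ∣))
∣∪∣+∣∩∣ (true ∷ X) (false ∷ Y) = cong suc (∣∪∣+∣∩∣ X Y)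
∣∪∣+∣∩∣ (true ∷ X) (true ∷ Y) = cong suc
  (trans (ℕ.+-suc ∣ X ∪ Y ∣ ∣ X ∩ Y ∣)
    (trans (cong suc (∣∪∣+∣∩∣ X Y)) (sym (ℕ.+-suc ∣ X ∣ ∣ Y ∣))))

─-∩ : (E X Y : Subset n) → E ─ (X ∩ Y) ≡ (E ─ X) ∪ (E ─ Y)
─-∩ [] [] [] = refl
─-∩ (false ∷ E) (false ∷ X) (false ∷ Y) = cong (false ∷_) (─-∩ E X Y)
─-∩ (false ∷ E) (false ∷ X) (true  ∷ Y) = cong (false ∷_) (─-∩ E X Y)
─-∩ (false ∷ E) (true  ∷ X) (false ∷ Y) = cong (false ∷_) (─-∩ E X Y)
─-∩ (_     ∷ E) (true  ∷ X) (true  ∷ Y) = cong (false ∷_) (─-∩ E X Y)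
─-∩ (true  ∷ E) (false ∷ X) (_     ∷ Y) = cong (true ∷_) (─-∩ E X Y)
─-∩ (true  ∷ E) (true  ∷ X) (false ∷ Y) = cong (true ∷_) (─-∩ E X Y)

─-∪ : (E X Y : Subset n) → E ─ (X ∪ Y) ≡ (E ─ X) ∩ (E ─ Y)
─-∪ [] [] [] = refl
─-∪ (_     ∷ E) (true  ∷ X) (_     ∷ Y) = cong (false ∷_) (─-∪ E X Y)
─-∪ (false ∷ E) (false ∷ X) (false ∷ Y) = cong (false ∷_) (─-∪ E X Y)
─-∪ (false ∷ E) (false ∷ X) (true  ∷ Y) = cong (false ∷_) (─-∪ E X Y)
─-∪ (true  ∷ E) (false ∷ X) (false ∷ Y) = cong (true ∷_) (─-∪ E X Y)
─-∪ (true  ∷ E) (false ∷ X) (true  ∷ Y) = cong (false ∷_) (─-∪ E X Y)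

─-split : ∀ {X Y : Subset n} E → X ⊆ Y → Y ⊆ E → E ─ X ≡ (E ─ Y) ∪ (Y ─ X)
─-split {X = X} {Y} E X⊆Y Y⊆E = ⊆-antisym to from
  where
  to : E ─ X ⊆ (E ─ Y) ∪ (Y ─ X)
  to {e} e∈ with e ∈? Y
  ... | yes e∈Y = x∈p∪q⁺ (inj₂ (x∈p∧x∉q⇒x∈p─q e∈Y (x∈p─q⇒x∉q E X e∈)))
  ... | no  e∉Y = x∈p∪q⁺ (inj₁ (x∈p∧x∉q⇒x∈p─q (p─q⊆p E X e∈) e∉Y))
  from : (E ─ Y) ∪ (Y ─ X) ⊆ E ─ X
  from e∈ with x∈p∪q⁻ (E ─ Y) (Y ─ X) e∈
  ... | inj₁ e∈E─Y = ─-anti E X⊆Y e∈E─Y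
  ... | inj₂ e∈Y─X =
    x∈p∧x∉q⇒x∈p─q (Y⊆E (p─q⊆p Y X e∈Y─X)) (x∈p─q⇒x∉q Y X e∈Y─X)

⁅x⁆⊆p : ∀ {x : Fin n} {p} → x ∈ p → ⁅ x ⁆ ⊆ p
⁅x⁆⊆p {x = x} x∈p y∈ with refl ← x∈⁅y⁆⇒x≡y x y∈ = x∈p

-∪⁅⁆ : ∀ {x : Fin n} {p} → x ∈ p → p ≡ (p ─ ⁅ x ⁆) ∪ ⁅ x ⁆
-∪⁅⁆ {x = x} {p} x∈p = ⊆-antisym to from
  where
  to : p ⊆ (p ─ ⁅ x ⁆) ∪ ⁅ x ⁆
  to {y} y∈p with y ∈? ⁅ x ⁆
  ... | yes y∈x = x∈p∪q⁺ (inj₂ y∈x)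
  ... | no  y∉x = x∈p∪q⁺ (inj₁ (x∈p∧x∉q⇒x∈p─q y∈p y∉x))
  from : (p ─ ⁅ x ⁆) ∪ ⁅ x ⁆ ⊆ p
  from y∈ with x∈p∪q⁻ (p ─ ⁅ x ⁆) ⁅ x ⁆ y∈
  ... | inj₁ y∈p-x = p─q⊆p p ⁅ x ⁆ y∈p-x
  ... | inj₂ y∈x   = ⁅x⁆⊆p x∈p y∈x

∪-lub : {X Y E : Subset n} → X ⊆ E → Y ⊆ E → X ∪ Y ⊆ E
∪-lub {X = X} {Y} X⊆E Y⊆E e∈ with x∈p∪q⁻ X Y e∈
... | inj₁ e∈X = X⊆E e∈X
... | inj₂ e∈Y = Y⊆E e∈Y

p─p≡⊥ : (p : Subset n) → p ─ p ≡ ⊥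
p─p≡⊥ [] = refl
p─p≡⊥ (false ∷ p) = cong (false ∷_) (p─p≡⊥ p)
p─p≡⊥ (true  ∷ p) = cong (false ∷_) (p─p≡⊥ p)

p─[p─q]≡q : {p q : Subset n} → q ⊆ p → p ─ (p ─ q) ≡ q
p─[p─q]≡q {p = []} {[]} q⊆p = refl
p─[p─q]≡q {p = false ∷ p} {false ∷ q} q⊆p = cong (false ∷_) (p─[p─q]≡q (drop-∷-⊆ q⊆p))
p─[p─q]≡q {p = false ∷ p} {true ∷ q} q⊆p with () ← q⊆p here
p─[p─q]≡q {p = true ∷ p} {false ∷ q} q⊆p = cong (false ∷_) (p─[p─q]≡q (drop-∷-⊆ q⊆p))
p─[p─q]≡q {p = true ∷ p} {true ∷ q} q⊆p = cong (true ∷_) (p─[p─q]≡q (drop-∷-⊆ q⊆p))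

module PolymatroidProperties {E : Subset n} {ρ : Subset n → ℤ}
  (isPolymatroid : IsPolymatroid E ρ) where

  open IsPolymatroid isPolymatroid public
  open ℤ.≤-Reasoning

  nonNegative : ∀ {X} → X ⊆ E → 0ℤ ≤ ρ X
  nonNegative {X} X⊆E =
    subst (_≤ ρ X) normalized (monotone (⊆-min X) X⊆E)

  subadditive : ∀ {X Y} → X ⊆ E → Y ⊆ E → ρ (X ∪ Y) ≤ ρ X + ρ Y
  subadditive {X} {Y} X⊆E Y⊆E = begin
    ρ (X ∪ Y)              ≡⟨ ℤ.+-identityʳ _ ⟨
    ρ (X ∪ Y) + 0ℤ         ≤⟨ ℤ.+-monoʳ-≤ (ρ (X ∪ Y)) (nonNegative (X⊆E ∘ p∩q⊆p X Y)) ⟩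
    ρ (X ∪ Y) + ρ (X ∩ Y)  ≤⟨ submodular X⊆E Y⊆E ⟩
    ρ X + ρ Y              ∎

  rank≤i∣X∣ : (∀ {e} → e ∈ E → ρ ⁅ e ⁆ ≤ + i) →
              ∀ {X} → X ⊆ E → ρ X ≤ + i * + ∣ X ∣
  rank≤i∣X∣ {i = i} bounded {X} = go X (<-wellFounded ∣ X ∣)
    where
    go : ∀ X → Acc ℕ._<_ ∣ X ∣ → X ⊆ E → ρ X ≤ + i * + ∣ X ∣
    go X (acc rec) X⊆E with nonempty? X
    ... | no X-empty with refl ← Empty-unique X-empty = begin
      ρ ⊥                            ≡⟨ normalized ⟩
      0ℤ                             ≡⟨ ℤ.*-zeroʳ (+ i) ⟨
      + i * 0ℤ                       ≡⟨ cong (λ m → + i * + m) (∣⊥∣≡0 n) ⟨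
      + i * + ∣ ⊥ {n} ∣              ∎
    ... | yes (x , x∈X) = begin
      ρ X                            ≡⟨ cong ρ (-∪⁅⁆ x∈X) ⟩
      ρ ((X ─ ⁅ x ⁆) ∪ ⁅ x ⁆)            ≤⟨ subadditive X-x⊆E (⁅x⁆⊆p (X⊆E x∈X)) ⟩
      ρ (X ─ ⁅ x ⁆) + ρ ⁅ x ⁆            ≤⟨ ℤ.+-mono-≤ (go (X ─ ⁅ x ⁆) (rec (x∈p⇒∣p-x∣<∣p∣ x∈X)) X-x⊆E)
                                                   (bounded (X⊆E x∈X)) ⟩
      + i * + ∣ X ─ ⁅ x ⁆ ∣ + + i        ≡⟨ distrib (+ i) (+ ∣ X ─ ⁅ x ⁆ ∣) ⟩
      + i * + (∣ X ─ ⁅ x ⁆ ∣ ℕ.+ 1)      ≡⟨ cong (λ m → + i * + (∣ X ─ ⁅ x ⁆ ∣ ℕ.+ m)) (∣⁅x⁆∣≡1 x) ⟨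
      + i * + (∣ X ─ ⁅ x ⁆ ∣ ℕ.+ ∣ ⁅ x ⁆ ∣) ≡⟨ cong (λ m → + i * + m) (∣─∣ (⁅x⁆⊆p x∈X)) ⟩
      + i * + ∣ X ∣                  ∎
      where
      X-x⊆E : X ─ ⁅ x ⁆ ⊆ E
      X-x⊆E = X⊆E ∘ p─q⊆p X ⁅ x ⁆
      distrib : ∀ a b → a * b + a ≡ a * (b + 1ℤ)
      distrib = solve-∀

------------------------------------------------------------------------
-- The i-dual, and the dual matroid as the case i = 1

dualRank : ℕ → (E : Subset n) → (Subset n → ℤ) → Subset n → ℤ
dualRank i E ρ X = + i * + ∣ X ∣ - ρ E + ρ (E ─ X)

dual : {E : Subset n} → i -Polymatroid E → i -Polymatroid E
dual {n = n} {i} {E} P = record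
  { polymatroid = record
    { rank = ρ*
    ; isPolymatroid = record
      { normalized = normalized*
      ; monotone   = monotone*
      ; submodular = submodular*
      }
    }
  ; bounded = bounded*
  }
  where
  ρ  = rank (polymatroid P)
  ρ* = dualRank i E ρ
  open PolymatroidProperties (Polymatroid.isPolymatroid (polymatroid P))
  open ℤ.≤-Reasoning

  normalized* : ρ* ⊥ ≡ 0ℤ
  normalized* rewrite ∣⊥∣≡0 n | p─⊥≡p E = lemma (+ i) (ρ E)
    where
    lemma : ∀ a b → a * 0ℤ - b + b ≡ 0ℤ
    lemma = solve-∀

  monotone* : ∀ {X Y} → X ⊆ Y → Y ⊆ E → ρ* X ≤ ρ* Y
  monotone* {X} {Y} X⊆Y Y⊆E = begin
    + i * + ∣ X ∣ - ρ E + ρ (E ─ X)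
      ≡⟨ cong (λ Z → + i * + ∣ X ∣ - ρ E + ρ Z) (─-split E X⊆Y Y⊆E) ⟩
    + i * + ∣ X ∣ - ρ E + ρ ((E ─ Y) ∪ (Y ─ X))
      ≤⟨ ℤ.+-monoʳ-≤ (+ i * + ∣ X ∣ - ρ E) (subadditive (p─q⊆p E Y) Y─X⊆E) ⟩
    + i * + ∣ X ∣ - ρ E + (ρ (E ─ Y) + ρ (Y ─ X))
      ≤⟨ ℤ.+-monoʳ-≤ (+ i * + ∣ X ∣ - ρ E) (ℤ.+-monoʳ-≤ (ρ (E ─ Y))
           (rank≤i∣X∣ (_-Polymatroid_.bounded P) Y─X⊆E)) ⟩
    + i * + ∣ X ∣ - ρ E + (ρ (E ─ Y) + + i * + ∣ Y ─ X ∣)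
      ≡⟨ lemma (+ i) (+ ∣ X ∣) (ρ E) (ρ (E ─ Y)) (+ ∣ Y ─ X ∣) ⟩
    + i * + (∣ Y ─ X ∣ ℕ.+ ∣ X ∣) - ρ E + ρ (E ─ Y)
      ≡⟨ cong (λ m → + i * + m - ρ E + ρ (E ─ Y)) (∣─∣ X⊆Y) ⟩
    + i * + ∣ Y ∣ - ρ E + ρ (E ─ Y) ∎
    where
    Y─X⊆E : Y ─ X ⊆ E
    Y─X⊆E = Y⊆E ∘ p─q⊆p Y X
    lemma : ∀ a x e y d → a * x - e + (y + a * d) ≡ a * (d + x) - e + y
    lemma = solve-∀

  submodular* : ∀ {X Y} → X ⊆ E → Y ⊆ E →
                ρ* (X ∪ Y) + ρ* (X ∩ Y) ≤ ρ* X + ρ* Y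
  submodular* {X} {Y} X⊆E Y⊆E = begin
    ρ* (X ∪ Y) + ρ* (X ∩ Y)
      ≡⟨ cong₂ (λ U V → + i * + ∣ X ∪ Y ∣ - ρ E + ρ U + (+ i * + ∣ X ∩ Y ∣ - ρ E + ρ V))
               (─-∪ E X Y) (─-∩ E X Y) ⟩
    + i * + ∣ X ∪ Y ∣ - ρ E + ρ X̄∩Ȳ + (+ i * + ∣ X ∩ Y ∣ - ρ E + ρ X̄∪Ȳ)
      ≡⟨ collect (+ i) (+ ∣ X ∪ Y ∣) (+ ∣ X ∩ Y ∣) (ρ E) (ρ X̄∩Ȳ) (ρ X̄∪Ȳ) ⟩
    + i * + (∣ X ∪ Y ∣ ℕ.+ ∣ X ∩ Y ∣) - ρ E - ρ E + (ρ X̄∪Ȳ + ρ X̄∩Ȳ)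
      ≤⟨ ℤ.+-monoʳ-≤ (+ i * + (∣ X ∪ Y ∣ ℕ.+ ∣ X ∩ Y ∣) - ρ E - ρ E)
           (submodular (p─q⊆p E X) (p─q⊆p E Y)) ⟩
    + i * + (∣ X ∪ Y ∣ ℕ.+ ∣ X ∩ Y ∣) - ρ E - ρ E + (ρ (E ─ X) + ρ (E ─ Y))
      ≡⟨ cong (λ m → + i * + m - ρ E - ρ E + (ρ (E ─ X) + ρ (E ─ Y))) (∣∪∣+∣∩∣ X Y) ⟩
    + i * + (∣ X ∣ ℕ.+ ∣ Y ∣) - ρ E - ρ E + (ρ (E ─ X) + ρ (E ─ Y))
      ≡⟨ distribute (+ i) (+ ∣ X ∣) (+ ∣ Y ∣) (ρ E) (ρ (E ─ X)) (ρ (E ─ Y)) ⟩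
    ρ* X + ρ* Y ∎
    where
    X̄∩Ȳ = (E ─ X) ∩ (E ─ Y)
    X̄∪Ȳ = (E ─ X) ∪ (E ─ Y)
    collect : ∀ a x y e u v → a * x - e + u + (a * y - e + v) ≡ a * (x + y) - e - e + (v + u)
    collect = solve-∀
    distribute : ∀ a x y e u v → a * (x + y) - e - e + (u + v) ≡ a * x - e + u + (a * y - e + v)
    distribute = solve-∀

  bounded* : ∀ {e} → e ∈ E → ρ* ⁅ e ⁆ ≤ + i
  bounded* {e} e∈E = begin
    + i * + ∣ ⁅ e ⁆ ∣ - ρ E + ρ (E ─ ⁅ e ⁆)
      ≡⟨ cong (λ m → + i * + m - ρ E + ρ (E ─ ⁅ e ⁆)) (∣⁅x⁆∣≡1 e) ⟩
    + i * 1ℤ - ρ E + ρ (E ─ ⁅ e ⁆)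
      ≤⟨ ℤ.+-monoʳ-≤ (+ i * 1ℤ - ρ E) (monotone (p─q⊆p E ⁅ e ⁆) ⊆-refl) ⟩
    + i * 1ℤ - ρ E + ρ E
      ≡⟨ lemma (+ i) (ρ E) ⟩
    + i ∎
    where
    lemma : ∀ a b → a * 1ℤ - b + b ≡ a
    lemma = solve-∀

infix 9 _*ᴹ

_*ᴹ : {E : Subset n} → Matroid E → Matroid E
M *ᴹ = dual M

-- The bases of M *ᴹ are the complements of the bases of M, so this is
-- the usual dual matroid.

IsBasis : {E : Subset n} → Matroid E → Subset n → Set
IsBasis {E = E} M B = B ⊆ E × r M B ≡ + ∣ B ∣ × r M B ≡ r M E

basis-dual : {E : Subset n} (M : Matroid E) {B : Subset n} → B ⊆ E →
             IsBasis M B ⇔ IsBasis (M *ᴹ) (E ─ B)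
basis-dual {E = E} M {B} B⊆E = mk⇔
  (λ (_ , ind , span) → p─q⊆p E B , to₁ span , to₂ ind)
  (λ (_ , ind , span) → B⊆E , from₂ span , from₁ ind)
  where
  open Polymatroid (polymatroid M) using (isPolymatroid)
  open IsPolymatroid isPolymatroid using (normalized)
  c = + ∣ E ─ B ∣
  b = + ∣ B ∣

  r*E─B : r (M *ᴹ) (E ─ B) ≡ c - r M E + r M B
  r*E─B rewrite p─[p─q]≡q B⊆E | ℤ.*-identityˡ c = refl

  r*E : r (M *ᴹ) E ≡ c + b - r M E
  r*E rewrite p─p≡⊥ E | normalized | ℤ.*-identityˡ (+ ∣ E ∣)
    | ℤ.+-identityʳ (+ ∣ E ∣ - r M E) = cong (λ m → + m - r M E) (sym (∣─∣ B⊆E))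

  cancel : ∀ c e x → c - e + x - c + e ≡ x
  cancel = solve-∀
  arith₁ : ∀ c e → c - e + e ≡ c
  arith₁ = solve-∀
  arith₂ : ∀ c e b → c - e + b ≡ c + b - e
  arith₂ = solve-∀
  arith₃ : ∀ c e → c - c + e ≡ e
  arith₃ = solve-∀
  arith₄ : ∀ c e b → c + b - e - c + e ≡ b
  arith₄ = solve-∀

  to₁ : r M B ≡ r M E → r (M *ᴹ) (E ─ B) ≡ c
  to₁ p = trans r*E─B (trans (cong (λ x → c - r M E + x) p) (arith₁ c (r M E)))
  to₂ : r M B ≡ b → r (M *ᴹ) (E ─ B) ≡ r (M *ᴹ) E
  to₂ p = trans r*E─B (trans (cong (λ x → c - r M E + x) p) (trans (arith₂ c (r M E) b) (sym r*E)))
  from₁ : r (M *ᴹ) (E ─ B) ≡ c → r M B ≡ r M E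
  from₁ p = trans (sym (cancel c (r M E) (r M B)))
    (trans (cong (λ x → x - c + r M E) (trans (sym r*E─B) p)) (arith₃ c (r M E)))
  from₂ : r (M *ᴹ) (E ─ B) ≡ r (M *ᴹ) E → r M B ≡ b
  from₂ p = trans (sym (cancel c (r M E) (r M B)))
    (trans (cong (λ x → x - c + r M E) (trans (sym r*E─B) (trans p r*E))) (arith₄ c (r M E) b))

------------------------------------------------------------------------
-- Deletion of loops and coloops

loops : {E : Subset n} → Matroid E → Subset n
loops {E = E} M = tabulate λ e → does (e ∈? E) ∧ does (r M ⁅ e ⁆ ℤ.≟ 0ℤ)

coloops : {E : Subset n} → Matroid E → Subset n
coloops M = loops (M *ᴹ)

infixl 8 _╲_

_╲_ : {E : Subset n} → Matroid E → (D : Subset n) → Matroid (E ─ D)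
_╲_ {E = E} M D = record
  { polymatroid = record
    { rank = r M
    ; isPolymatroid = record
      { normalized = normalized
      ; monotone   = λ X⊆Y Y⊆E─D → monotone X⊆Y (p─q⊆p E D ∘ Y⊆E─D)
      ; submodular = λ X⊆E─D Y⊆E─D →
          submodular (p─q⊆p E D ∘ X⊆E─D) (p─q⊆p E D ∘ Y⊆E─D)
      }
    }
  ; bounded = λ e∈E─D → _-Polymatroid_.bounded M (p─q⊆p E D e∈E─D)
  }
  where
  open IsPolymatroid (Polymatroid.isPolymatroid (polymatroid M))

deleteLoopsColoops : {E : Subset n} (M : Matroid E) →
                     Matroid (E ─ (loops M ∪ coloops M))
deleteLoopsColoops M = M ╲ (loops M ∪ coloops M)

------------------------------------------------------------------------
-- Decompositions and the chromatic number

infix 4 _≐∑_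

_≐∑_ : {E : Subset n} → Polymatroid E → Vector (Matroid E) k → Set
_≐∑_ {E = E} ρ M = ∀ {X} → X ⊆ E → rank ρ X ≡ sum (λ j → r (M j) X)

Decomposable : {E : Subset n} → Polymatroid E → ℕ → Set
Decomposable {E = E} ρ k = ∃ λ (M : Vector (Matroid E) k) → ρ ≐∑ M

ℕ∞ : Set
ℕ∞ = ℕ ⁺

ℕ∞-totalOrder : TotalOrder 0ℓ 0ℓ 0ℓ
ℕ∞-totalOrder = record
  { isTotalOrder = AddSupremum.≤⁺-isTotalOrder-≡ ℕ._≤_ ℕ.≤-isTotalOrder }

open TotalOrder ℕ∞-totalOrder public using () renaming (_≤_ to _≤∞_)
open Min ℕ∞-totalOrder public using () renaming (_⊓_ to min)

IsChromaticNumber : {E : Subset n} → Polymatroid E → ℕ∞ → Set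
IsChromaticNumber ρ [ k ] =
  1 ℕ.≤ k × Decomposable ρ k × (∀ {l} → 1 ℕ.≤ l → Decomposable ρ l → k ℕ.≤ l)
IsChromaticNumber ρ ⊤⁺ = ∀ {l} → 1 ℕ.≤ l → ¬ Decomposable ρ l

private

  IsMatroidRank : Subset n → (Subset n → ℤ) → Set
  IsMatroidRank E f = IsPolymatroid E f × (∀ {e} → e ∈ E → f ⁅ e ⁆ ≤ + 1)

  Sum : Subset n → (Subset n → ℤ) → ℕ → Set
  Sum E f k = ∃ λ (M : Vector (Matroid E) k) →
              ∀ {X} → X ⊆ E → f X ≡ sum (λ j → r (M j) X)

  rank-resp : ∀ {E : Subset n} {f g} → (∀ {X} → X ⊆ E → f X ≡ g X) →
              IsMatroidRank E f → IsMatroidRank E g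
  rank-resp {E = E} {f} {g} f≡g (poly , bounded) =
    record
      { normalized = trans (sym (f≡g (⊆-min E))) normalized
      ; monotone   = λ X⊆Y Y⊆E →
          subst₂ _≤_ (f≡g (Y⊆E ∘ X⊆Y)) (f≡g Y⊆E) (monotone X⊆Y Y⊆E)
      ; submodular = λ {X} {Y} X⊆E Y⊆E →
          subst₂ _≤_ (cong₂ _+_ (f≡g (∪-lub X⊆E Y⊆E)) (f≡g (X⊆E ∘ p∩q⊆p X Y)))
                     (cong₂ _+_ (f≡g X⊆E) (f≡g Y⊆E)) (submodular X⊆E Y⊆E)
      }
    , λ e∈E → subst (_≤ + 1) (f≡g (⁅x⁆⊆p e∈E)) (bounded e∈E)
    where open IsPolymatroid poly

  allSubsets? : {P : Subset n → Set} → (∀ X → Dec (P X)) → Dec (∀ X → P X)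
  allSubsets? P? with anySubset? (¬? ∘ P?)
  ... | yes (X , ¬p) = no λ all → ¬p (all X)
  ... | no ¬∃¬ = yes λ X → decidable-stable (P? X) λ ¬p → ¬∃¬ (X , ¬p)

  isMatroidRank? : ∀ (E : Subset n) f → Dec (IsMatroidRank E f)
  isMatroidRank? E f = map′
    (λ (n , m , s , b) →
      record { normalized = n ; monotone = m _ _ ; submodular = s _ _ } , b _)
    (λ (p , b) → let open IsPolymatroid p in
      normalized , (λ _ _ → monotone) , (λ _ _ → submodular) , λ _ → b)
    ( f ⊥ ℤ.≟ 0ℤ
    ×-dec allSubsets? (λ X → allSubsets? λ Y →
            X ⊆? Y →-dec (Y ⊆? E →-dec f X ℤ.≤? f Y))
    ×-dec allSubsets? (λ X → allSubsets? λ Y →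
            X ⊆? E →-dec (Y ⊆? E →-dec f (X ∪ Y) + f (X ∩ Y) ℤ.≤? f X + f Y))
    ×-dec Fin.all? λ e → e ∈? E →-dec f ⁅ e ⁆ ℤ.≤? + 1)

  anyTable? : ∀ {m} n {P : (Subset n → Fin m) → Set} →
              (∀ {f g} → f ≗ g → P f → P g) →
              (∀ f → Dec (P f)) → Dec (∃ P)
  anyTable? zero resp P? = map′
    (λ (a , p) → (λ _ → a) , p)
    (λ (f , p) → f [] , resp (λ { [] → refl }) p)
    (Fin.any? λ a → P? λ _ → a)
  anyTable? {m} (suc n) {P} resp P? = map′
    (λ (f , g , p) → join f g , p)
    (λ (h , p) → h ∘ (false ∷_) , h ∘ (true ∷_) ,
      resp (λ { (false ∷ _) → refl ; (true ∷ _) → refl }) p)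
    (anyTable? n
      (λ f≗f′ (g , p) → g , resp (λ { (false ∷ X) → f≗f′ X ; (true ∷ _) → refl }) p)
      λ f → anyTable? n
        (λ g≗g′ → resp λ { (false ∷ _) → refl ; (true ∷ X) → g≗g′ X })
        λ g → P? (join f g))
    where
    join : (Subset n → Fin m) → (Subset n → Fin m) → Subset (suc n) → Fin m
    join f g (false ∷ X) = f X
    join f g (true  ∷ X) = g X

  sum? : ∀ (E : Subset n) k f → Dec (Sum E f k)
  sum? E zero f = map′
    (λ f≡0 → (λ ()) , f≡0 _)
    (λ (_ , f≡0) _ → f≡0)
    (allSubsets? λ X → X ⊆? E →-dec f X ℤ.≟ 0ℤ)
  sum? {n = n} E (suc k) f = map′ to from (anyTable? n resp′ λ t →
    isMatroidRank? E (value t) ×-dec sum? E k (λ X → f X - value t X))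
    where
    value : (Subset n → Fin (suc n)) → Subset n → ℤ
    value t X = + toℕ (t X)

    P : (Subset n → Fin (suc n)) → Set
    P t = IsMatroidRank E (value t) × Sum E (λ X → f X - value t X) k

    resp′ : ∀ {t u} → t ≗ u → P t → P u
    resp′ t≗u (matroid , M , eq) =
      rank-resp (λ {X} _ → cong (+_ ∘ toℕ) (t≗u X)) matroid , M ,
      λ {X} X⊆E → trans (cong (λ a → f X - + toℕ a) (sym (t≗u X))) (eq X⊆E)

    add-sub : ∀ a b → a ≡ b + (a - b)
    add-sub = solve-∀
    sub-add : ∀ a b → (b + a) - b ≡ a
    sub-add = solve-∀

    to : ∃ P → Sum E f (suc k)
    to (t , (poly , bounded) , M , eq) =
      (λ { zero → record { polymatroid = record { rank = value t ; isPolymatroid = poly }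
                         ; bounded = bounded }
         ; (suc j) → M j }) ,
      λ {X} X⊆E → trans (add-sub (f X) (value t X)) (cong (λ a → value t X + a) (eq X⊆E))

    from : Sum E f (suc k) → ∃ P
    from (M , eq) = t , rank-resp (sym ∘ value-t) (poly , bounded) , M ∘ suc ,
      λ {X} X⊆E → trans (cong₂ _-_ (eq X⊆E) (value-t X⊆E))
                        (sub-add (sum (λ j → r (M (suc j)) X)) (r (M zero) X))
      where
      r₀ = r (M zero)
      poly = Polymatroid.isPolymatroid (polymatroid (M zero))
      bounded = _-Polymatroid_.bounded (M zero)
      open PolymatroidProperties poly

      +∣r₀∣ : ∀ {X} → X ⊆ E → + ℤ.∣ r₀ X ∣ ≡ r₀ X
      +∣r₀∣ X⊆E = ℤ.0≤i⇒+∣i∣≡i (nonNegative X⊆E)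

      ∣r₀∣≤n : ∀ {X} → X ⊆ E → ℤ.∣ r₀ X ∣ ℕ.≤ n
      ∣r₀∣≤n {X} X⊆E = ℕ.≤-trans
        (ℤ.drop‿+≤+ (subst₂ _≤_ (sym (+∣r₀∣ X⊆E)) (ℤ.*-identityˡ (+ ∣ X ∣))
          (rank≤i∣X∣ bounded X⊆E)))
        (∣p∣≤n X)

      t : Subset n → Fin (suc n)
      t X = fromℕ< (s≤s (∣r₀∣≤n (p∩q⊆q X E)))

      value-t : ∀ {X} → X ⊆ E → value t X ≡ r₀ X
      value-t {X} X⊆E = trans (cong +_ (Fin.toℕ-fromℕ< (s≤s (∣r₀∣≤n (p∩q⊆q X E)))))
        (trans (+∣r₀∣ (p∩q⊆q X E))
          (cong r₀ (⊆-antisym (p∩q⊆p X E) (λ e∈X → x∈p∩q⁺ (e∈X , X⊆E e∈X)))))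

  k≤sum : ∀ k (t : Vector ℤ k) → (∀ j → 1ℤ ≤ t j) → + k ≤ sum t
  k≤sum zero t 1≤t = ℤ.≤-refl
  k≤sum (suc k) t 1≤t = ℤ.+-mono-≤ (1≤t zero) (k≤sum k (t ∘ suc) (1≤t ∘ suc))

  -- Too many summands for the rank of E: one of them has rank 0.
  dropSummand : ∀ {E : Subset n} {f k} → f E ≤ + suc k →
                Sum E f (suc (suc k)) → Sum E f (suc k)
  dropSummand {E = E} {f} {k} fE≤ (M , eq) with Fin.any? (λ j → r (M j) E ℤ.≤? 0ℤ)
  ... | yes (j , rE≤0) = removeAt M j , λ {X} X⊆E →
    let open PolymatroidProperties (Polymatroid.isPolymatroid (polymatroid (M j)))
        r≡0 : r (M j) X ≡ 0ℤ
        r≡0 = ℤ.≤-antisym (ℤ.≤-trans (monotone X⊆E ⊆-refl) rE≤0) (nonNegative X⊆E)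
    in trans (eq X⊆E) (trans (sum-remove {i = j} (λ l → r (M l) X))
         (trans (cong (_+ rest X j) r≡0) (ℤ.+-identityˡ (rest X j))))
    where
    rest : Subset _ → Fin (suc (suc k)) → ℤ
    rest X j = sum (removeAt (λ l → r (M l) X) j)
  ... | no none = ⊥-elim (ℕ.<-irrefl refl (ℤ.drop‿+≤+
    (ℤ.≤-trans (k≤sum _ _ λ j → ℤ.i<j⇒suc[i]≤j (ℤ.≰⇒> λ rE≤0 → none (j , rE≤0)))
      (subst (_≤ + suc k) (eq ⊆-refl) fE≤))))

  shrink : ∀ {E : Subset n} {f} k → Sum E f (suc k) →
           ∃ λ l → l ℕ.≤ ℤ.∣ f E ∣ × Sum E f (suc l)
  shrink zero M = zero , z≤n , M
  shrink {E = E} {f} (suc k) M with suc k ℕ.≤? ℤ.∣ f E ∣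
  ... | yes k≤ = suc k , k≤ , M
  ... | no k≰ = shrink k (dropSummand
    (ℤ.≤-trans (i≤∣i∣ (f E)) (+≤+ (ℕ.<⇒≤ (ℕ.≰⇒> k≰)))) M)
    where
    i≤∣i∣ : ∀ i → i ≤ + ℤ.∣ i ∣
    i≤∣i∣ (+ _) = ℤ.≤-refl
    i≤∣i∣ ℤ.-[1+ _ ] = ℤ.-≤+

  least : {P : ℕ → Set} → (∀ k → Dec (P k)) → ∀ B →
          (∃ λ k → P k × (∀ {l} → P l → k ℕ.≤ l)) ⊎ (∀ {l} → l ℕ.< B → ¬ P l)
  least P? zero = inj₂ λ ()
  least P? (suc B) with least P? B | P? B
  ... | inj₁ found | _      = inj₁ found
  ... | inj₂ none  | yes p  = inj₁ (B , p , λ q → ℕ.≮⇒≥ λ l<B → none l<B q)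
  ... | inj₂ none  | no  ¬p = inj₂ λ l<1+B q → case-≤ (ℕ.m<1+n⇒m<n∨m≡n l<1+B) q
    where
    case-≤ : ∀ {l} → l ℕ.< B ⊎ l ≡ B → ¬ _
    case-≤ (inj₁ l<B)  = none l<B
    case-≤ (inj₂ refl) = ¬p

-- A decomposition of ρ can be shortened to at most 1 + ρ(E) matroids by
-- dropping matroids of rank 0, and for each number of matroids there
-- are finitely many candidates, so the chromatic number is computable.

abstract
  chromaticNumber : {E : Subset n} (ρ : Polymatroid E) → ∃ (IsChromaticNumber ρ)
  chromaticNumber {E = E} ρ
    with least (λ l → sum? E (suc l) (rank ρ)) (suc ℤ.∣ rank ρ E ∣)
  ... | inj₁ (l , M , min) =
    [ suc l ] , s≤s z≤n , M , λ { (s≤s _) N → s≤s (min N) }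
  ... | inj₂ none = ⊤⁺ , λ { (s≤s {n = l} _) N →
    let l′ , l′≤ , N′ = shrink l N in none (s≤s l′≤) N′ }

χ : {E : Subset n} → Polymatroid E → ℕ∞
χ ρ = proj₁ (chromaticNumber ρ)

χ-isChromaticNumber : {E : Subset n} (ρ : Polymatroid E) → IsChromaticNumber ρ (χ ρ)
χ-isChromaticNumber ρ = proj₂ (chromaticNumber ρ)

{-# OPTIONS --safe #-}
-- Dualising each M_j gives rank sum ρ*(X) + (k - i)|X|, so a surplus of k - i
-- has to be removed at every element.  Since ρ({e}) ≤ i, the element e is a loop
-- of at least k - i of the M_j, hence a coloop of their duals; turning exactly
-- k - i of these coloops into loops removes the surplus and leaves the matroids
-- unchanged away from loops and coloops.

module Submission where

open import Data.Nat using (ℕ; _≤_)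
open import Data.Fin using (Fin)
open import Data.Fin.Subset using (Subset)
open import Data.Product using (∃; _×_)
open import Data.Vec.Functional using (Vector)
open import Relation.Binary.PropositionalEquality using (_≡_)
open import Relation.Nullary.Construct.Add.Supremum using ([_])
open import Defs

import Algebra.Construct.NaturalChoice.Min as Min
open import Data.Bool.Base using (true; false; _∧_)
open import Data.Empty using (⊥-elim)
open import Data.Fin.Base using (zero; suc)
open import Data.Fin.Subset hiding (_-_)
open import Data.Fin.Subset.Properties
open import Data.Integer.Base as ℤ using (ℤ; +_; 0ℤ; 1ℤ; _+_; _-_; _*_)
import Data.Integer.Properties as ℤ
open import Algebra.Properties.CommutativeMonoid.Sum ℤ.+-0-commutativeMonoid
  using (sum-cong-≗; ∑-distrib-+)
open import Data.Integer.Tactic.RingSolver using (solve-∀)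
open import Data.Nat.Base as ℕ using (zero; suc; _∸_; z≤n; s≤s)
import Data.Nat.Properties as ℕ
open import Data.Product using (_,_; proj₁; proj₂)
open import Data.Sum.Base using (inj₁; inj₂; [_,_]′)
open import Data.Vec.Base using ([]; _∷_; tabulate; lookup; here; there)
open import Data.Vec.Properties using ([]=⇒lookup; lookup⇒[]=; lookup∘tabulate)
open import Function.Base using (_∘_)
open import Relation.Binary.Construct.Add.Supremum.NonStrict ℕ._≤_ using ([≤]-injective)
open import Relation.Binary.PropositionalEquality
open import Relation.Nullary
open import Relation.Nullary.Construct.Add.Supremum using (⊤⁺)
open import Relation.Nullary.Decidable using (dec-true)

private
  variable
    n i k : ℕ

-- Finite sets

x∈p─q⁻ : ∀ {x : Fin n} (p q : Subset n) → x ∈ p ─ q → x ∈ p × x ∉ q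
x∈p─q⁻ p q x∈ = p─q⊆p p q x∈ , x∈p─q⇒x∉q p q x∈

─-monoˡ : ∀ {p q : Subset n} c → p ⊆ q → p ─ c ⊆ q ─ c
─-monoˡ {p = p} c p⊆q x∈ with x∈p , x∉c ← x∈p─q⁻ p c x∈ = x∈p∧x∉q⇒x∈p─q (p⊆q x∈p) x∉c

∪-─-⊆ : (p q c : Subset n) → (p ∪ q) ─ c ⊆ (p ─ c) ∪ (q ─ c)
∪-─-⊆ p q c x∈ with x∈p∪q , x∉c ← x∈p─q⁻ (p ∪ q) c x∈ | x∈p∪q⁻ p q (p─q⊆p (p ∪ q) c x∈)
... | inj₁ x∈p = x∈p∪q⁺ (inj₁ (x∈p∧x∉q⇒x∈p─q x∈p x∉c))
... | inj₂ x∈q = x∈p∪q⁺ (inj₂ (x∈p∧x∉q⇒x∈p─q x∈q x∉c))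

∩-─-⊆ : (p q c : Subset n) → (p ∩ q) ─ c ⊆ (p ─ c) ∩ (q ─ c)
∩-─-⊆ p q c x∈ = x∈p∩q⁺ (─-monoˡ c (p∩q⊆p p q) x∈ , ─-monoˡ c (p∩q⊆q p q) x∈)

p⊆q⇒p─q≡⊥ : {p q : Subset n} → p ⊆ q → p ─ q ≡ ⊥
p⊆q⇒p─q≡⊥ {p = p} {q} p⊆q =
  Empty-unique λ (_ , x∈) → let x∈p , x∉q = x∈p─q⁻ p q x∈ in x∉q (p⊆q x∈p)

disjoint⇒p─q≡p : {p q : Subset n} → (∀ {x} → x ∈ p → x ∉ q) → p ─ q ≡ p
disjoint⇒p─q≡p {p = p} {q} disj =
  ⊆-antisym (p─q⊆p p q) λ x∈p → x∈p∧x∉q⇒x∈p─q x∈p (disj x∈p)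

⁅x⁆─p≡⊥ : ∀ {x : Fin n} {p} → x ∈ p → ⁅ x ⁆ ─ p ≡ ⊥
⁅x⁆─p≡⊥ x∈p = p⊆q⇒p─q≡⊥ (⁅x⁆⊆p x∈p)

⁅x⁆─p≡⁅x⁆ : ∀ {x : Fin n} {p} → x ∉ p → ⁅ x ⁆ ─ p ≡ ⁅ x ⁆
⁅x⁆─p≡⁅x⁆ {x = x} x∉p =
  disjoint⇒p─q≡p λ y∈ y∈p → x∉p (subst (_∈ _) (x∈⁅y⁆⇒x≡y x y∈) y∈p)

∣∩∣+∣─∣ : (p q : Subset n) → ∣ p ∩ q ∣ ℕ.+ ∣ p ─ q ∣ ≡ ∣ p ∣
∣∩∣+∣─∣ [] [] = refl
∣∩∣+∣─∣ (false ∷ p) (false ∷ q) = ∣∩∣+∣─∣ p q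
∣∩∣+∣─∣ (false ∷ p) (true  ∷ q) = ∣∩∣+∣─∣ p q
∣∩∣+∣─∣ (true  ∷ p) (true  ∷ q) = cong suc (∣∩∣+∣─∣ p q)
∣∩∣+∣─∣ (true  ∷ p) (false ∷ q) =
  trans (ℕ.+-suc ∣ p ∩ q ∣ ∣ p ─ q ∣) (cong suc (∣∩∣+∣─∣ p q))

-- Subsets of prescribed size and incidence relations.

takeElements : ℕ → Subset n → Subset n
takeElements d       []          = []
takeElements d       (false ∷ p) = false ∷ takeElements d p
takeElements zero    (true ∷ p)  = false ∷ takeElements zero p
takeElements (suc d) (true ∷ p)  = true ∷ takeElements d p

takeElements-⊆ : ∀ d (p : Subset n) → takeElements d p ⊆ p
takeElements-⊆ d       (false ∷ p) (there x∈) = there (takeElements-⊆ d p x∈)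
takeElements-⊆ zero    (true ∷ p)  (there x∈) = there (takeElements-⊆ zero p x∈)
takeElements-⊆ (suc d) (true ∷ p)  here       = here
takeElements-⊆ (suc d) (true ∷ p)  (there x∈) = there (takeElements-⊆ d p x∈)

∣takeElements∣ : ∀ d (p : Subset n) → d ≤ ∣ p ∣ → ∣ takeElements d p ∣ ≡ d
∣takeElements∣ zero    []          _         = refl
∣takeElements∣ d       (false ∷ p) d≤        = ∣takeElements∣ d p d≤
∣takeElements∣ zero    (true ∷ p)  _         = ∣takeElements∣ zero p z≤n
∣takeElements∣ (suc d) (true ∷ p)  (s≤s d≤)  = cong suc (∣takeElements∣ d p d≤)

-- Reads `T` as a 0/1 incidence matrix between elements and summand indices. It converts "where is
-- `e` a loop" into "which elements are loops of the matroid at `s`", and back.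
transpose : (Fin n → Subset k) → Fin k → Subset n
transpose T s = tabulate λ e → lookup (T e) s

∈-transpose⁺ : ∀ (T : Fin n → Subset k) {s e} → s ∈ T e → e ∈ transpose T s
∈-transpose⁺ T {s} {e} s∈ =
  lookup⇒[]= e _ (trans (lookup∘tabulate _ e) ([]=⇒lookup s∈))

∈-transpose⁻ : ∀ (T : Fin n → Subset k) {s e} → e ∈ transpose T s → s ∈ T e
∈-transpose⁻ T {s} {e} e∈ =
  lookup⇒[]= s _ (trans (sym (lookup∘tabulate _ e)) ([]=⇒lookup e∈))

-- Integer sums

-- Inductive step of the double count: prepending one element of the ground set to the sets `P s`
-- adds one unit for each index that lies in `T`.
∑-∣lookup∷∣ : ∀ (T : Subset k) (P : Fin k → Subset n) →
              sum (λ s → + ∣ lookup T s ∷ P s ∣) ≡ + ∣ T ∣ + sum (λ s → + ∣ P s ∣)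
∑-∣lookup∷∣ [] P = refl
∑-∣lookup∷∣ (true ∷ T) P =
  trans (cong (λ z → + suc ∣ P zero ∣ + z) (∑-∣lookup∷∣ T (P ∘ suc)))
        (lemma (+ ∣ P zero ∣) (+ ∣ T ∣) (sum λ s → + ∣ P (suc s) ∣))
  where
  lemma : ∀ a b c → (1ℤ + a) + (b + c) ≡ (1ℤ + b) + (a + c)
  lemma = solve-∀
∑-∣lookup∷∣ (false ∷ T) P =
  trans (cong (λ z → + ∣ P zero ∣ + z) (∑-∣lookup∷∣ T (P ∘ suc)))
        (lemma (+ ∣ P zero ∣) (+ ∣ T ∣) (sum λ s → + ∣ P (suc s) ∣))
  where
  lemma : ∀ a b c → a + (b + c) ≡ b + (a + c)
  lemma = solve-∀

-- Both sides count the pairs of an element `e ∈ X` and an index in `T e`. The induction removes the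
-- ground set's first element, which contributes `d` pairs if it lies in `X` and none otherwise.
double-counting : ∀ {d} (X : Subset n) (T : Fin n → Subset k) →
                  (∀ {e} → e ∈ X → ∣ T e ∣ ≡ d) →
                  sum (λ s → + ∣ X ∩ transpose T s ∣) ≡ + d * + ∣ X ∣
double-counting {k = k} {d} [] T _ = trans (zeros k) (sym (ℤ.*-zeroʳ (+ d)))
  where
  zeros : ∀ k → sum {k} (λ _ → 0ℤ) ≡ 0ℤ
  zeros zero    = refl
  zeros (suc k) = trans (ℤ.+-identityˡ _) (zeros k)
double-counting (false ∷ X) T ∣T∣≡d = double-counting X (T ∘ suc) (∣T∣≡d ∘ there)
double-counting {d = d} (true ∷ X) T ∣T∣≡d = trans
  (∑-∣lookup∷∣ (T zero) (λ s → X ∩ transpose (T ∘ suc) s))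
  (trans (cong₂ _+_ (cong +_ (∣T∣≡d here)) (double-counting X (T ∘ suc) (∣T∣≡d ∘ there)))
         (lemma (+ d) (+ ∣ X ∣)))
  where
  lemma : ∀ a b → a + a * b ≡ a * (1ℤ + b)
  lemma = solve-∀

-- The factor `1ℤ` is kept so that each summand is literally a value of `dualRank 1`.
∑-dualRank : ∀ k x (a b : Vector ℤ k) →
             sum (λ j → 1ℤ * x - a j + b j) ≡ + k * x - sum a + sum b
∑-dualRank zero x a b = lemma x
  where
  lemma : ∀ x → 0ℤ ≡ 0ℤ * x - 0ℤ + 0ℤ
  lemma = solve-∀
∑-dualRank (suc k) x a b = trans
  (cong (λ z → 1ℤ * x - a zero + b zero + z) (∑-dualRank k x (a ∘ suc) (b ∘ suc)))
  (lemma (+ k) x (a zero) (b zero) (sum (a ∘ suc)) (sum (b ∘ suc)))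
  where
  lemma : ∀ k x a b A B →
          1ℤ * x - a + b + (k * x - A + B) ≡ (1ℤ + k) * x - (a + A) + (b + B)
  lemma = solve-∀

-- Every index contributes at least 1 on the right, either through `S` or through its entry of `t`.
-- With `S` the indices at which an element is a loop and `t` its ranks, this bounds the number of
-- loops from below.
k≤∣S∣+sum : ∀ (S : Subset k) (t : Vector ℤ k) → (∀ s → 0ℤ ℤ.≤ t s) →
            (∀ {s} → s ∉ S → 1ℤ ℤ.≤ t s) → + k ℤ.≤ + ∣ S ∣ + sum t
k≤∣S∣+sum [] t _ _ = ℤ.≤-refl
-- If `b` is `false`, index `zero` lies outside `b ∷ S`, so its entry is at least 1.
k≤∣S∣+sum {suc k} (b ∷ S) t 0≤t 1≤t = step b (λ { refl → 1≤t λ () })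
  where
  rest : + k ℤ.≤ + ∣ S ∣ + sum (t ∘ suc)
  rest = k≤∣S∣+sum S (t ∘ suc) (0≤t ∘ suc) λ s∉S → 1≤t λ { (there s∈S) → s∉S s∈S }

  arith₁ : ∀ a u v → (1ℤ + a) + (u + v) ≡ (1ℤ + u) + (a + v)
  arith₁ = solve-∀
  arith₂ : ∀ a u v → a + (u + v) ≡ u + (a + v)
  arith₂ = solve-∀

  step : ∀ c → (c ≡ false → 1ℤ ℤ.≤ t zero) → + suc k ℤ.≤ + ∣ c ∷ S ∣ + sum t
  step true _ = subst (+ suc k ℤ.≤_) (sym (arith₁ (+ ∣ S ∣) (t zero) (sum (t ∘ suc))))
    (ℤ.+-mono-≤ (ℤ.+-monoʳ-≤ 1ℤ (0≤t zero)) rest)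
  step false 1≤ = subst (+ suc k ℤ.≤_) (sym (arith₂ (+ ∣ S ∣) (t zero) (sum (t ∘ suc))))
    (ℤ.+-mono-≤ (1≤ refl) rest)

-- Sets of rank zero

isPolymatroid-⊆ : ∀ {D E : Subset n} {ρ} → D ⊆ E → IsPolymatroid E ρ → IsPolymatroid D ρ
isPolymatroid-⊆ D⊆E isP = record
  { normalized = normalized
  ; monotone   = λ X⊆Y Y⊆D → monotone X⊆Y (D⊆E ∘ Y⊆D)
  ; submodular = λ X⊆D Y⊆D → submodular (D⊆E ∘ X⊆D) (D⊆E ∘ Y⊆D)
  }
  where open IsPolymatroid isP

-- Restricted to `D`, the function is a 0-polymatroid, so the bound of the rank by `i` times the
-- cardinality applies with `i = 0`.
rank-zero : ∀ {D E : Subset n} {ρ} → IsPolymatroid E ρ → D ⊆ E →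
            (∀ {e} → e ∈ D → ρ ⁅ e ⁆ ≡ 0ℤ) → ρ D ≡ 0ℤ
rank-zero {D = D} {ρ = ρ} isP D⊆E ρe≡0 = ℤ.≤-antisym
  (subst (ρ D ℤ.≤_) (ℤ.*-zeroˡ (+ ∣ D ∣))
    (rank≤i∣X∣ {i = 0} (λ e∈D → ℤ.≤-reflexive (ρe≡0 e∈D)) ⊆-refl))
  (nonNegative ⊆-refl)
  where open PolymatroidProperties (isPolymatroid-⊆ D⊆E isP)

-- Monotonicity and subadditivity squeeze `ρ Y` between `ρ X` and `ρ X + ρ D`. Allowing any `Y`
-- between `X` and `X ∪ D` lets complements be compared by inclusions instead of computed exactly.
rank-absorb : ∀ {D E X Y : Subset n} {ρ} → IsPolymatroid E ρ → D ⊆ E → ρ D ≡ 0ℤ →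
              X ⊆ E → X ⊆ Y → Y ⊆ X ∪ D → ρ Y ≡ ρ X
rank-absorb {D = D} {E} {X} {Y} {ρ} isP D⊆E ρD≡0 X⊆E X⊆Y Y⊆X∪D = ℤ.≤-antisym
  (begin
    ρ Y        ≤⟨ monotone Y⊆X∪D X∪D⊆E ⟩
    ρ (X ∪ D)  ≤⟨ subadditive X⊆E D⊆E ⟩
    ρ X + ρ D  ≡⟨ cong (λ z → ρ X + z) ρD≡0 ⟩
    ρ X + 0ℤ   ≡⟨ ℤ.+-identityʳ (ρ X) ⟩
    ρ X        ∎)
  (monotone X⊆Y (X∪D⊆E ∘ Y⊆X∪D))
  where
  open PolymatroidProperties isP
  open ℤ.≤-Reasoning

  X∪D⊆E : X ∪ D ⊆ E
  X∪D⊆E = ∪-lub X⊆E D⊆E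

-- Loops and sets of loops.

∈-loops⁺ : ∀ {E : Subset n} (M : Matroid E) {e} → e ∈ E → r M ⁅ e ⁆ ≡ 0ℤ → e ∈ loops M
∈-loops⁺ {E = E} M {e} e∈E re≡0 = lookup⇒[]= e _ (trans (lookup∘tabulate _ e)
  (cong₂ _∧_ (dec-true (e ∈? E) e∈E) (dec-true (r M ⁅ e ⁆ ℤ.≟ 0ℤ) re≡0)))

∈-loops⁻ : ∀ {E : Subset n} (M : Matroid E) {e} → e ∈ loops M → e ∈ E × r M ⁅ e ⁆ ≡ 0ℤ
∈-loops⁻ {E = E} M {e} e∈
  with e ∈? E | r M ⁅ e ⁆ ℤ.≟ 0ℤ | trans (sym (lookup∘tabulate _ e)) ([]=⇒lookup e∈)
... | yes e∈E | yes re≡0 | _ = e∈E , re≡0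

isPolymatroid : ∀ {E : Subset n} (P : i -Polymatroid E) → IsPolymatroid E (rank (polymatroid P))
isPolymatroid P = Polymatroid.isPolymatroid (polymatroid P)

loops⊆E : ∀ {E : Subset n} (M : Matroid E) → loops M ⊆ E
loops⊆E M = proj₁ ∘ ∈-loops⁻ M

r-⊆loops : ∀ {E C : Subset n} (M : Matroid E) → C ⊆ loops M → r M C ≡ 0ℤ
r-⊆loops M C⊆L =
  rank-zero (isPolymatroid M) (loops⊆E M ∘ C⊆L) (proj₂ ∘ ∈-loops⁻ M ∘ C⊆L)

-- Turning the elements of a set into loops

-- Deletes `C` and puts its elements back as loops, so that the ground set stays `E`.
loopify : ∀ {E : Subset n} → Subset n → Matroid E → Matroid E
loopify {E = E} C M = record
  { polymatroid = record
    { rank = λ X → r M (X ─ C)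
    ; isPolymatroid = record
      { normalized = trans (cong (r M) (p⊆q⇒p─q≡⊥ (⊆-min C))) normalized
      ; monotone   = λ {X} {Y} X⊆Y Y⊆E → monotone (─-monoˡ C X⊆Y) (Y⊆E ∘ p─q⊆p Y C)
      ; submodular = λ {X} {Y} X⊆E Y⊆E → ℤ.≤-trans
          (ℤ.+-mono-≤
            (monotone (∪-─-⊆ X Y C) (∪-lub (X⊆E ∘ p─q⊆p X C) (Y⊆E ∘ p─q⊆p Y C)))
            (monotone (∩-─-⊆ X Y C) (X⊆E ∘ p─q⊆p X C ∘ p∩q⊆p (X ─ C) (Y ─ C))))
          (submodular (X⊆E ∘ p─q⊆p X C) (Y⊆E ∘ p─q⊆p Y C))
      }
    }
  ; bounded = λ {e} e∈E → ℤ.≤-trans (monotone (p─q⊆p ⁅ e ⁆ C) (⁅x⁆⊆p e∈E))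
                                    (_-Polymatroid_.bounded M e∈E)
  }
  where open IsPolymatroid (isPolymatroid M)

-- The complement of `X ─ C` exceeds that of `X` only by loops of `M`, so in the dual rank formula
-- only the cardinality changes: each coloop of the dual in `X ∩ C` costs exactly one unit.
r*-loopify : ∀ {E C X : Subset n} (M : Matroid E) → C ⊆ loops M → X ⊆ E →
             r (loopify C (M *ᴹ)) X + + ∣ X ∩ C ∣ ≡ r (M *ᴹ) X
r*-loopify {E = E} {C} {X} M C⊆L X⊆E = begin
  1ℤ * + ∣ X ─ C ∣ - r M E + r M (E ─ (X ─ C)) + + ∣ X ∩ C ∣
    ≡⟨ cong (λ z → 1ℤ * + ∣ X ─ C ∣ - r M E + z + + ∣ X ∩ C ∣) absorb ⟩
  1ℤ * + ∣ X ─ C ∣ - r M E + r M (E ─ X) + + ∣ X ∩ C ∣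
    ≡⟨ lemma (+ ∣ X ─ C ∣) (r M E) (r M (E ─ X)) (+ ∣ X ∩ C ∣) ⟩
  1ℤ * (+ ∣ X ∩ C ∣ + + ∣ X ─ C ∣) - r M E + r M (E ─ X)
    ≡⟨ cong (λ m → 1ℤ * + m - r M E + r M (E ─ X)) (∣∩∣+∣─∣ X C) ⟩
  1ℤ * + ∣ X ∣ - r M E + r M (E ─ X) ∎
  where
  open ≡-Reasoning
  lemma : ∀ a e b c → 1ℤ * a - e + b + c ≡ 1ℤ * (c + a) - e + b
  lemma = solve-∀

  E─[X─C]⊆ : E ─ (X ─ C) ⊆ (E ─ X) ∪ C
  E─[X─C]⊆ {e} e∈ with e∈E , e∉X─C ← x∈p─q⁻ E (X ─ C) e∈ | e ∈? C
  ... | yes e∈C = x∈p∪q⁺ (inj₂ e∈C)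
  ... | no  e∉C =
    x∈p∪q⁺ (inj₁ (x∈p∧x∉q⇒x∈p─q e∈E λ e∈X → e∉X─C (x∈p∧x∉q⇒x∈p─q e∈X e∉C)))

  absorb : r M (E ─ (X ─ C)) ≡ r M (E ─ X)
  absorb = rank-absorb (isPolymatroid M) (loops⊆E M ∘ C⊆L) (r-⊆loops M C⊆L)
    (p─q⊆p E X) (─-anti E (p─q⊆p X C)) E─[X─C]⊆

-- Identifies the coloops of the modified dual outside `C` with the loops of `M` there. Expanding
-- both duals leaves only complements that agree with the empty set or with `⁅ e ⁆` up to elements
-- of `C`, which have rank 0.
r**-loopify : ∀ {E C : Subset n} (M : Matroid E) → C ⊆ loops M →
              ∀ {e} → e ∈ E → e ∉ C → r (loopify C (M *ᴹ) *ᴹ) ⁅ e ⁆ ≡ r M ⁅ e ⁆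
r**-loopify {E = E} {C} M C⊆L {e} e∈E e∉C = begin
  1ℤ * + ∣ ⁅ e ⁆ ∣ - (1ℤ * + ∣ E ─ C ∣ - r M E + r M (E ─ (E ─ C)))
    + (1ℤ * + ∣ A ∣ - r M E + r M (E ─ A))
    ≡⟨ cong₂ (λ u v → 1ℤ * + ∣ ⁅ e ⁆ ∣ - (1ℤ * + ∣ E ─ C ∣ - r M E + u)
                        + (1ℤ * + ∣ A ∣ - r M E + v))
             (trans (cong (r M) (p─[p─q]≡q C⊆E)) (r-⊆loops M C⊆L)) absorb ⟩
  1ℤ * + ∣ ⁅ e ⁆ ∣ - (1ℤ * + ∣ E ─ C ∣ - r M E + 0ℤ)
    + (1ℤ * + ∣ A ∣ - r M E + r M ⁅ e ⁆)
    ≡⟨ cong (λ m → 1ℤ * + ∣ ⁅ e ⁆ ∣ - (1ℤ * + m - r M E + 0ℤ)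
                        + (1ℤ * + ∣ A ∣ - r M E + r M ⁅ e ⁆))
            (sym ∣A∣+∣e∣) ⟩
  1ℤ * + ∣ ⁅ e ⁆ ∣ - (1ℤ * (+ ∣ A ∣ + + ∣ ⁅ e ⁆ ∣) - r M E + 0ℤ)
    + (1ℤ * + ∣ A ∣ - r M E + r M ⁅ e ⁆)
    ≡⟨ lemma (+ ∣ ⁅ e ⁆ ∣) (+ ∣ A ∣) (r M E) (r M ⁅ e ⁆) ⟩
  r M ⁅ e ⁆ ∎
  where
  open ≡-Reasoning
  -- The rank of `E ─ ⁅ e ⁆` in the modified dual is by definition the dual rank of `A`.
  A = (E ─ ⁅ e ⁆) ─ C

  C⊆E : C ⊆ E
  C⊆E = loops⊆E M ∘ C⊆L

  lemma : ∀ x a b c → 1ℤ * x - (1ℤ * (a + x) - b + 0ℤ) + (1ℤ * a - b + c) ≡ c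
  lemma = solve-∀

  ∣A∣+∣e∣ : ∣ A ∣ ℕ.+ ∣ ⁅ e ⁆ ∣ ≡ ∣ E ─ C ∣
  ∣A∣+∣e∣ = trans (cong (λ Z → ∣ Z ∣ ℕ.+ ∣ ⁅ e ⁆ ∣) (p─q─r≡p─r─q E ⁅ e ⁆ C))
    (∣─∣ (⁅x⁆⊆p (x∈p∧x∉q⇒x∈p─q e∈E e∉C)))

  e∈E─A : e ∈ E ─ A
  e∈E─A = x∈p∧x∉q⇒x∈p─q e∈E λ e∈A →
    x∈p─q⇒x∉q E ⁅ e ⁆ (p─q⊆p (E ─ ⁅ e ⁆) C e∈A) (x∈⁅x⁆ e)

  E─A⊆ : E ─ A ⊆ ⁅ e ⁆ ∪ C
  E─A⊆ {x} x∈ with x∈E , x∉A ← x∈p─q⁻ E A x∈ | x ∈? ⁅ e ⁆ | x ∈? C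
  ... | yes x∈e | _       = x∈p∪q⁺ (inj₁ x∈e)
  ... | no  _   | yes x∈C = x∈p∪q⁺ (inj₂ x∈C)
  ... | no  x∉e | no  x∉C = ⊥-elim (x∉A (x∈p∧x∉q⇒x∈p─q (x∈p∧x∉q⇒x∈p─q x∈E x∉e) x∉C))

  absorb : r M (E ─ A) ≡ r M ⁅ e ⁆
  absorb = rank-absorb (isPolymatroid M) C⊆E (r-⊆loops M C⊆L)
    (⁅x⁆⊆p e∈E) (⁅x⁆⊆p e∈E─A) E─A⊆

-- Elements of `C` are loops of both `M` and `M′`. Outside `C` the two kinds are exchanged, as under
-- ordinary duality.
loops∪coloops-loopify : ∀ {E C : Subset n} (M : Matroid E) → C ⊆ loops M →
  let M′ = loopify C (M *ᴹ) in loops M′ ∪ coloops M′ ≡ loops M ∪ coloops M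
loops∪coloops-loopify {E = E} {C} M C⊆L = ⊆-antisym to from
  where
  M′ = loopify C (M *ᴹ)

  to : loops M′ ∪ coloops M′ ⊆ loops M ∪ coloops M
  to {e} e∈ with e ∈? C | x∈p∪q⁻ (loops M′) (coloops M′) e∈
  ... | yes e∈C | _ = x∈p∪q⁺ (inj₁ (C⊆L e∈C))
  ... | no  e∉C | inj₁ loop with e∈E , r≡0 ← ∈-loops⁻ M′ loop = x∈p∪q⁺ (inj₂
    (∈-loops⁺ (M *ᴹ) e∈E (trans (cong (r (M *ᴹ)) (sym (⁅x⁆─p≡⁅x⁆ e∉C))) r≡0)))
  ... | no  e∉C | inj₂ coloop with e∈E , r≡0 ← ∈-loops⁻ (M′ *ᴹ) coloop = x∈p∪q⁺ (inj₁
    (∈-loops⁺ M e∈E (trans (sym (r**-loopify M C⊆L e∈E e∉C)) r≡0)))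

  from : loops M ∪ coloops M ⊆ loops M′ ∪ coloops M′
  from {e} e∈ with e ∈? C | x∈p∪q⁻ (loops M) (coloops M) e∈
  ... | yes e∈C | _ = x∈p∪q⁺ (inj₁ (∈-loops⁺ M′ (loops⊆E M (C⊆L e∈C))
    (trans (cong (r (M *ᴹ)) (⁅x⁆─p≡⊥ e∈C)) (IsPolymatroid.normalized (isPolymatroid (M *ᴹ))))))
  ... | no  e∉C | inj₁ loop with e∈E , r≡0 ← ∈-loops⁻ M loop = x∈p∪q⁺ (inj₂
    (∈-loops⁺ (M′ *ᴹ) e∈E (trans (r**-loopify M C⊆L e∈E e∉C) r≡0)))
  ... | no  e∉C | inj₂ coloop with e∈E , r≡0 ← ∈-loops⁻ (M *ᴹ) coloop = x∈p∪q⁺ (inj₁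
    (∈-loops⁺ M′ e∈E (trans (cong (r (M *ᴹ)) (⁅x⁆─p≡⁅x⁆ e∉C)) r≡0)))

-- Deletion of loops and coloops

-- Coloops are loops of the dual, so adding all of them to `X` keeps the dual rank. Rewritten in
-- terms of `r M`, this says that removing them from `E ─ X` lowers the rank by their number; what
-- is left differs from `F ─ X` only by loops.
r-delete : ∀ {E X : Subset n} (M : Matroid E) →
  let F = E ─ (loops M ∪ coloops M) in
  X ⊆ F → r M (E ─ X) ≡ + ∣ coloops M ∣ + r M (F ─ X)
r-delete {n = n} {E} {X} M X⊆F = begin
  r M (E ─ X)
    ≡⟨ solveFor (+ ∣ X ∣) (r M E) (r M (E ─ X)) ⟩
  r (M *ᴹ) X - (1ℤ * + ∣ X ∣ - r M E)
    ≡⟨ cong (_- (1ℤ * + ∣ X ∣ - r M E)) absorb* ⟨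
  r (M *ᴹ) (X ∪ K) - (1ℤ * + ∣ X ∣ - r M E)
    ≡⟨ cong₂ (λ m z → 1ℤ * + m - r M E + z - (1ℤ * + ∣ X ∣ - r M E)) ∣X∪K∣ absorb ⟩
  1ℤ * (+ ∣ X ∣ + + ∣ K ∣) - r M E + r M (F ─ X) - (1ℤ * + ∣ X ∣ - r M E)
    ≡⟨ cancel (+ ∣ X ∣) (+ ∣ K ∣) (r M E) (r M (F ─ X)) ⟩
  + ∣ K ∣ + r M (F ─ X) ∎
  where
  open ≡-Reasoning
  L = loops M
  K = coloops M
  F = E ─ (L ∪ K)

  X⊆E : X ⊆ E
  X⊆E = p─q⊆p E (L ∪ K) ∘ X⊆F

  solveFor : ∀ x e z → z ≡ 1ℤ * x - e + z - (1ℤ * x - e)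
  solveFor = solve-∀
  cancel : ∀ x k e z → 1ℤ * (x + k) - e + z - (1ℤ * x - e) ≡ k + z
  cancel = solve-∀

  absorb* : r (M *ᴹ) (X ∪ K) ≡ r (M *ᴹ) X
  absorb* = rank-absorb (isPolymatroid (M *ᴹ)) (loops⊆E (M *ᴹ)) (r-⊆loops (M *ᴹ) ⊆-refl)
    X⊆E (p⊆p∪q K) ⊆-refl

  X∩K≡⊥ : X ∩ K ≡ ⊥
  X∩K≡⊥ = Empty-unique λ (_ , e∈) → let e∈X , e∈K = x∈p∩q⁻ X K e∈ in
    x∈p─q⇒x∉q E (L ∪ K) (X⊆F e∈X) (x∈p∪q⁺ (inj₂ e∈K))

  ∣X∪K∣ : ∣ X ∪ K ∣ ≡ ∣ X ∣ ℕ.+ ∣ K ∣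
  ∣X∪K∣ = trans (sym (trans
    (cong (∣ X ∪ K ∣ ℕ.+_) (trans (cong ∣_∣ X∩K≡⊥) (∣⊥∣≡0 n)))
    (ℕ.+-identityʳ _))) (∣∪∣+∣∩∣ X K)

  F─X⊆ : F ─ X ⊆ E ─ (X ∪ K)
  F─X⊆ e∈ with e∈F , e∉X ← x∈p─q⁻ F X e∈ with e∈E , e∉L∪K ← x∈p─q⁻ E (L ∪ K) e∈F =
    x∈p∧x∉q⇒x∈p─q e∈E ([ e∉X , e∉L∪K ∘ x∈p∪q⁺ ∘ inj₂ ]′ ∘ x∈p∪q⁻ X K)

  ⊆F─X∪L : E ─ (X ∪ K) ⊆ (F ─ X) ∪ L
  ⊆F─X∪L {e} e∈ with e∈E , e∉X∪K ← x∈p─q⁻ E (X ∪ K) e∈ | e ∈? L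
  ... | yes e∈L = x∈p∪q⁺ (inj₂ e∈L)
  ... | no  e∉L = x∈p∪q⁺ (inj₁ (x∈p∧x∉q⇒x∈p─q
    (x∈p∧x∉q⇒x∈p─q e∈E ([ e∉L , e∉X∪K ∘ x∈p∪q⁺ ∘ inj₂ ]′ ∘ x∈p∪q⁻ L K))
    (e∉X∪K ∘ x∈p∪q⁺ ∘ inj₁)))

  absorb : r M (E ─ (X ∪ K)) ≡ r M (F ─ X)
  absorb = rank-absorb (isPolymatroid M) (loops⊆E M) (r-⊆loops M ⊆-refl)
    (p─q⊆p E (L ∪ K) ∘ p─q⊆p F X) F─X⊆ ⊆F─X∪L

-- A set `X` that avoids loops and coloops is disjoint from `C`, so its rank is its rank in `M *ᴹ`.
-- Passing from `E` to `F` changes both rank terms of the dual formula by the number of coloops,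
-- which cancels.
deleteLoopsColoops-loopify : ∀ {E C : Subset n} (M : Matroid E) → C ⊆ loops M →
  deleteLoopsColoops (loopify C (M *ᴹ)) ≅ deleteLoopsColoops M *ᴹ
deleteLoopsColoops-loopify {E = E} {C} M C⊆L =
  cong (E ─_) D′≡D , λ X⊆ → ranks (subst (λ D → _ ⊆ E ─ D) D′≡D X⊆)
  where
  open ≡-Reasoning
  D′≡D = loops∪coloops-loopify M C⊆L
  D = loops M ∪ coloops M
  F = E ─ D

  lemma : ∀ x k e z → 1ℤ * x - (k + e) + (k + z) ≡ 1ℤ * x - e + z
  lemma = solve-∀

  ranks : ∀ {X} → X ⊆ F → r (M *ᴹ) (X ─ C) ≡ r (deleteLoopsColoops M *ᴹ) X
  ranks {X} X⊆F = begin
    r (M *ᴹ) (X ─ C)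
      ≡⟨ cong (r (M *ᴹ)) (disjoint⇒p─q≡p λ e∈X e∈C →
           x∈p─q⇒x∉q E D (X⊆F e∈X) (x∈p∪q⁺ (inj₁ (C⊆L e∈C)))) ⟩
    1ℤ * + ∣ X ∣ - r M E + r M (E ─ X)
      ≡⟨ cong₂ (λ u v → 1ℤ * + ∣ X ∣ - u + v) rE (r-delete M X⊆F) ⟩
    1ℤ * + ∣ X ∣ - (+ ∣ coloops M ∣ + r M F) + (+ ∣ coloops M ∣ + r M (F ─ X))
      ≡⟨ lemma (+ ∣ X ∣) (+ ∣ coloops M ∣) (r M F) (r M (F ─ X)) ⟩
    1ℤ * + ∣ X ∣ - r M F + r M (F ─ X) ∎
    where
    -- The case of the empty set in `r-delete`.
    rE : r M E ≡ + ∣ coloops M ∣ + r M F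
    rE = subst₂ (λ U V → r M U ≡ + ∣ coloops M ∣ + r M V) (p─⊥≡p E) (p─⊥≡p F)
           (r-delete M (⊆-min F))

-- Decompositions of the dual

-- The dual rank formula is linear, so dualising `k` summands yields the `k`-dual, whatever bound
-- `ρ` satisfies on singletons.
∑-r* : ∀ {E X : Subset n} (ρ : Polymatroid E) (M : Vector (Matroid E) k) → ρ ≐∑ M →
       sum (λ j → r (M j *ᴹ) X) ≡ dualRank k E (rank ρ) X
∑-r* {k = k} {E} {X} ρ M ρ≐∑M = trans
  (∑-dualRank k (+ ∣ X ∣) (λ j → r (M j) E) (λ j → r (M j) (E ─ X)))
  (sym (cong₂ (λ u v → + k * + ∣ X ∣ - u + v) (ρ≐∑M ⊆-refl) (ρ≐∑M (p─q⊆p E X))))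

module _ {E : Subset n} (ρ : i -Polymatroid E) (i≤k : i ≤ k)
         (M : Vector (Matroid E) k) (ρ≐∑M : polymatroid ρ ≐∑ M) where

  private
    d = k ∸ i

    loopIndices : Fin n → Subset k
    loopIndices = transpose λ s → loops (M s)

    -- The `d` indices at which `e`, a coloop of the dual, is turned into a loop.
    loopified : Fin n → Subset k
    loopified e = takeElements d (loopIndices e)

    C : Fin k → Subset n
    C = transpose loopified

    -- Each summand in which `e` is not a loop contributes at least 1 to the rank of `⁅ e ⁆`, which
    -- is at most `i`; hence there are at most `i` such summands.
    d≤∣loopIndices∣ : ∀ {e} → e ∈ E → d ≤ ∣ loopIndices e ∣
    d≤∣loopIndices∣ {e} e∈E = ℕ.m≤n+o⇒m∸n≤o k i (subst (k ≤_) (ℕ.+-comm ∣ S ∣ i)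
      (ℤ.drop‿+≤+ (ℤ.≤-trans (k≤∣S∣+sum S (λ s → r (M s) ⁅ e ⁆) 0≤r 1≤r)
        (ℤ.+-monoʳ-≤ (+ ∣ S ∣) (subst (ℤ._≤ + i) (ρ≐∑M (⁅x⁆⊆p e∈E))
          (_-Polymatroid_.bounded ρ e∈E))))))
      where
      S = loopIndices e

      0≤r : ∀ s → 0ℤ ℤ.≤ r (M s) ⁅ e ⁆
      0≤r s = PolymatroidProperties.nonNegative (isPolymatroid (M s)) (⁅x⁆⊆p e∈E)

      1≤r : ∀ {s} → s ∉ S → 1ℤ ℤ.≤ r (M s) ⁅ e ⁆
      1≤r {s} s∉S = ℤ.i<j⇒suc[i]≤j (ℤ.≤∧≢⇒< (0≤r s) λ 0≡r →
        s∉S (∈-transpose⁺ (λ s → loops (M s)) (∈-loops⁺ (M s) e∈E (sym 0≡r))))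

    C⊆loops : ∀ s → C s ⊆ loops (M s)
    C⊆loops s e∈C = ∈-transpose⁻ (λ s → loops (M s))
      (takeElements-⊆ d _ (∈-transpose⁻ loopified e∈C))

    M′ : Vector (Matroid E) k
    M′ s = loopify (C s) (M s *ᴹ)

    ρ*≐∑M′ : polymatroid (dual ρ) ≐∑ M′
    ρ*≐∑M′ {X} X⊆E = begin
      dualRank i E (rank (polymatroid ρ)) X
        -- The `i`-dual is the `k`-dual minus `d` for each element of `X`, because `i + d` equals
        -- `k`.
        ≡⟨ arith₁ (+ i) (+ d) (+ ∣ X ∣) ρE (ρ⟨ E ─ X ⟩) ⟩
      (+ i + + d) * + ∣ X ∣ - ρE + ρ⟨ E ─ X ⟩ - + d * + ∣ X ∣
        ≡⟨ cong (λ m → + m * + ∣ X ∣ - ρE + ρ⟨ E ─ X ⟩ - + d * + ∣ X ∣) (ℕ.m+[n∸m]≡n i≤k) ⟩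
      dualRank k E (rank (polymatroid ρ)) X - + d * + ∣ X ∣
        -- Every element of `X` lies in exactly `d` of the sets `C s`, so the surplus is spread over
        -- the summands.
        ≡⟨ cong₂ _-_ (sym (∑-r* (polymatroid ρ) M ρ≐∑M))
             (sym (double-counting X loopified λ {e} e∈X →
               ∣takeElements∣ d (loopIndices e) (d≤∣loopIndices∣ (X⊆E e∈X)))) ⟩
      sum (λ s → r (M s *ᴹ) X) - sum (λ s → + ∣ X ∩ C s ∣)
        ≡⟨ cong (_- sum (λ s → + ∣ X ∩ C s ∣))
             (sum-cong-≗ λ s → sym (r*-loopify (M s) (C⊆loops s) X⊆E)) ⟩
      sum (λ s → r (M′ s) X + + ∣ X ∩ C s ∣) - sum (λ s → + ∣ X ∩ C s ∣)
        ≡⟨ cong (_- sum (λ s → + ∣ X ∩ C s ∣))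
             (∑-distrib-+ (λ s → r (M′ s) X) (λ s → + ∣ X ∩ C s ∣)) ⟩
      sum (λ s → r (M′ s) X) + sum (λ s → + ∣ X ∩ C s ∣) - sum (λ s → + ∣ X ∩ C s ∣)
        ≡⟨ arith₂ (sum λ s → r (M′ s) X) (sum λ s → + ∣ X ∩ C s ∣) ⟩
      sum (λ s → r (M′ s) X) ∎
      where
      open ≡-Reasoning
      ρ⟨_⟩ = rank (polymatroid ρ)
      ρE = ρ⟨ E ⟩
      arith₁ : ∀ i d x e z → i * x - e + z ≡ (i + d) * x - e + z - d * x
      arith₁ = solve-∀
      arith₂ : ∀ a b → a + b - b ≡ a
      arith₂ = solve-∀

  dualDecomposition : ∃ λ (M′ : Vector (Matroid E) k) →
    polymatroid (dual ρ) ≐∑ M′ ×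
    (∀ (s : Fin k) → deleteLoopsColoops (M′ s) ≅ deleteLoopsColoops (M s) *ᴹ)
  dualDecomposition = M′ , ρ*≐∑M′ , λ s → deleteLoopsColoops-loopify (M s) (C⊆loops s)

-- Chromatic numbers

dual-decomposable : ∀ {E : Subset n} (ρ : i -Polymatroid E) → i ≤ k →
  Decomposable (polymatroid ρ) k → Decomposable (polymatroid (dual ρ)) k
dual-decomposable ρ i≤k (M , ρ≐∑M) =
  let M′ , ρ*≐∑M′ , _ = dualDecomposition ρ i≤k M ρ≐∑M in M′ , ρ*≐∑M′

dual-involutive : ∀ {E X : Subset n} (ρ : i -Polymatroid E) → X ⊆ E →
  rank (polymatroid (dual (dual ρ))) X ≡ rank (polymatroid ρ) X
dual-involutive {i = i} {E} {X} ρ X⊆E = begin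
  + i * + ∣ X ∣ - (+ i * + ∣ E ∣ - f E + f (E ─ E)) + (+ i * + ∣ E ─ X ∣ - f E + f (E ─ (E ─ X)))
    ≡⟨ cong₂ (λ u v → + i * + ∣ X ∣ - (+ i * + ∣ E ∣ - f E + u) + (+ i * + ∣ E ─ X ∣ - f E + v))
             (trans (cong f (p─p≡⊥ E)) normalized) (cong f (p─[p─q]≡q X⊆E)) ⟩
  + i * + ∣ X ∣ - (+ i * + ∣ E ∣ - f E + 0ℤ) + (+ i * + ∣ E ─ X ∣ - f E + f X)
    ≡⟨ cong (λ m → + i * + ∣ X ∣ - (+ i * + m - f E + 0ℤ) + (+ i * + ∣ E ─ X ∣ - f E + f X))
            (sym (∣─∣ X⊆E)) ⟩
  + i * + ∣ X ∣ - (+ i * (+ ∣ E ─ X ∣ + + ∣ X ∣) - f E + 0ℤ) + (+ i * + ∣ E ─ X ∣ - f E + f X)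
    ≡⟨ lemma (+ i) (+ ∣ X ∣) (+ ∣ E ─ X ∣) (f E) (f X) ⟩
  f X ∎
  where
  open ≡-Reasoning
  open IsPolymatroid (isPolymatroid ρ)
  f = rank (polymatroid ρ)
  lemma : ∀ i x y e z → i * x - (i * (y + x) - e + 0ℤ) + (i * y - e + z) ≡ z
  lemma = solve-∀

-- The forward direction applied to `dual ρ`, whose `i`-dual agrees with `ρ` on subsets of `E`.
dual-decomposable⁻ : ∀ {E : Subset n} (ρ : i -Polymatroid E) → i ≤ k →
  Decomposable (polymatroid (dual ρ)) k → Decomposable (polymatroid ρ) k
dual-decomposable⁻ ρ i≤k dec =
  let M , ρ**≐∑M = dual-decomposable (dual ρ) i≤k dec
  in M , λ X⊆E → trans (sym (dual-involutive ρ X⊆E)) (ρ**≐∑M X⊆E)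

-- Each finite value is at least `i`, so its decomposition transfers to the other polymatroid. Two
-- finite values then bound each other by minimality, and a finite value excludes an infinite one.
isChromaticNumber-unique : ∀ {E : Subset n} {ρ σ : Polymatroid E} →
  (∀ {k} → i ≤ k → Decomposable ρ k → Decomposable σ k) →
  (∀ {k} → i ≤ k → Decomposable σ k → Decomposable ρ k) →
  ∀ {c d} → [ i ] ≤∞ c → [ i ] ≤∞ d →
  IsChromaticNumber ρ c → IsChromaticNumber σ d → c ≡ d
isChromaticNumber-unique ρ⇒σ σ⇒ρ {[ k ]} {[ l ]} i≤k i≤l (1≤k , ρk , k-min) (1≤l , σl , l-min) =
  cong [_] (ℕ.≤-antisym (k-min 1≤l (σ⇒ρ ([≤]-injective i≤l) σl))
                        (l-min 1≤k (ρ⇒σ ([≤]-injective i≤k) ρk)))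
isChromaticNumber-unique ρ⇒σ σ⇒ρ {[ k ]} {⊤⁺} i≤k _ (1≤k , ρk , _) σ-none =
  ⊥-elim (σ-none 1≤k (ρ⇒σ ([≤]-injective i≤k) ρk))
isChromaticNumber-unique ρ⇒σ σ⇒ρ {⊤⁺} {[ l ]} _ i≤l ρ-none (1≤l , σl , _) =
  ⊥-elim (ρ-none 1≤l (σ⇒ρ ([≤]-injective i≤l) σl))
isChromaticNumber-unique ρ⇒σ σ⇒ρ {⊤⁺} {⊤⁺} _ _ _ _ = refl

theorem4p1 : ∀ {n} (E : Subset n) (i : ℕ) (ρ : i -Polymatroid E) →
    ((M : Vector (Matroid E) i) → polymatroid ρ ≐∑ M →
       polymatroid (dual ρ) ≐∑ (λ j → M j *ᴹ)) ×
    (∀ k → i ≤ k → (M : Vector (Matroid E) k) → polymatroid ρ ≐∑ M →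
       ∃ λ (M′ : Vector (Matroid E) k) →
         polymatroid (dual ρ) ≐∑ M′ ×
         (∀ (s : Fin k) → deleteLoopsColoops (M′ s) ≅ deleteLoopsColoops (M s) *ᴹ)) ×
    ([ i ] ≤∞ min (χ (polymatroid ρ)) (χ (polymatroid (dual ρ))) →
       χ (polymatroid ρ) ≡ χ (polymatroid (dual ρ)))
theorem4p1 E i ρ =
  (λ M ρ≐∑M _ → sym (∑-r* (polymatroid ρ) M ρ≐∑M)) ,
  (λ k i≤k M ρ≐∑M → dualDecomposition ρ i≤k M ρ≐∑M) ,
  λ i≤min → isChromaticNumber-unique {ρ = polymatroid ρ} {σ = polymatroid (dual ρ)}
    (dual-decomposable ρ) (dual-decomposable⁻ ρ)
    -- A lower bound for the minimum bounds both chromatic numbers from below.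
    (x≤y⊓z⇒x≤y χρ χρ* i≤min) (x≤y⊓z⇒x≤z χρ χρ* i≤min)
    (χ-isChromaticNumber (polymatroid ρ)) (χ-isChromaticNumber (polymatroid (dual ρ)))
  where
  open Min ℕ∞-totalOrder using (x≤y⊓z⇒x≤y; x≤y⊓z⇒x≤z)
  χρ  = χ (polymatroid ρ)
  χρ* = χ (polymatroid (dual ρ))
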